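{- Let $x_1,\ldots,x_7$ be an enumeration of the nodes (points) and $\ell_1,\ldots,\ell_7$ an enumeration of the lines of the Fano plane on the node set $\{1,\ldots,7\}$, such that $x_r\in\ell_r$ for $r=1,\ldots,7$. For each $r$, let $T_r$ be the knockout tournament on the $8$ players $0,1,\ldots,7$ that arises from the node-line pair $(x_r,\ell_r)$. Then the Serial Knockout Competition $\mathcal{T}:=\{T_1,\ldots,T_7\}$ is stable.
   Context: Knockout tournaments. A (balanced) knockout tournament $T$ on $n=2^k$ players is given by a seeding, i.e. an ordering $s=s_0s_1\cdots s_{n-1}$ of the players assigned from left to right to the leaves of a complete binary tree of depth $k$. In round $1$ the players in positions $2j$ and $2j+1$ meet; in each later round, the winners of the two subtrees below a node meet. For distinct players $x,x'$ we write $v_T(x,x')=i$ if $x,x'$ can meet in round $i$ of $T$ (assuming both win all earlier matches); equivalently, if $x,x'$ are in positions $p,p'$, then $i\in\{1,\ldots,k\}$ is the smallest integer with $\lfloor p/2^i\rfloor=\lfloor p'/2^i\rfloor$. Stability. A set $\mathcal{T}$ of knockout tournaments on the same $n=2^k$ players is stable in round $i$ if there is a number $c_i$ such that $\#\{T\in\mathcal{T}: v_T(x,x')=i\}=c_i$ for all pairs of distinct players $x,x'$. The set $\mathcal{T}$ is stable if it is stable in all rounds $i=1,\ldots,k$. A Serial Knockout Competition (SKC) for $n=2^k$ players is a competition consisting of $n-1$ knockout tournaments on these players. Fano plane. The nodes are $1,\ldots,7$ and the lines are $\{3,5,6\},\{2,4,6\},\{1,2,3\},\{1,6,7\},\{3,4,7\},\{1,4,5\},\{2,5,7\}$.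 Tournament arising from a node-line pair. Let $x$ be a node and $\ell$ a line with $x\in\ell$. Write $\ell=\{x,a,b\}$ and let $\{x,c,d\}$ and $\{x,e,f\}$ be the other two lines through $x$. The knockout tournament arising from $(x,\ell)$ has players $0,1,\ldots,7$ and seeding $0\,x\,a\,b\,c\,d\,e\,f$. (So $0$ and $x$ meet in round $1$, as do $a,b$, and $c,d$, and $e,f$; the winners of $\{0,x\}$ and $\{a,b\}$ meet in round $2$, as do the winners of $\{c,d\}$ and $\{e,f\}$. The choices in naming $a,b$, in naming $c,d$, in naming $e,f$, and in ordering the two remaining lines do not affect $v_T$.) -}

module Defs where

open import Data.Fin using (Fin; zero; suc; toℕ)
open import Data.Fin.Patterns using (0F; 1F; 2F; 3F; 4F; 5F; 6F)
open import Data.Fin.Subset using (Subset; ⁅_⁆; _∪_)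
open import Data.Nat using (ℕ; _^_; _∸_; _/_; _≤_; _<_; _≟_; _≤?_)
open import Data.Nat.Properties using (m^n≢0; allUpTo?)
open import Data.Product using (∃-syntax; _×_)
open import Data.Vec using (Vec; []; _∷_; allFin; count; lookup; tabulate)
open import Function.Bundles using (_↔_; _⇔_; Inverse)
open import Function.Definitions using (Injective)
open import Relation.Binary.PropositionalEquality using (_≡_; _≢_)
open import Relation.Nullary using (Dec; ¬_; ¬?; _×-dec_; _→-dec_)

record Tournament (k : ℕ) (P : Set) : Set where
  field
    seeding : Fin (2 ^ k) ↔ P

  player : Fin (2 ^ k) → P
  player = Inverse.to seeding

  position : P → ℕ
  position x = toℕ (Inverse.from seeding x)

open Tournament public

-- ⌊ p / 2 ^ i ⌋, which identifies the height-i subtree containing leaf p.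
subtree : ℕ → ℕ → ℕ
subtree i p = _/_ p (2 ^ i) {{m^n≢0 2 i}}

SameSubtree : ∀ {k P} → Tournament k P → P → P → ℕ → Set
SameSubtree T x y i = subtree i (position T x) ≡ subtree i (position T y)

-- MeetIn T x y i is v_T(x, y) = i, with v_T given by its graph: i is the
-- smallest element of {1, …, k} at which x and y share a subtree.  It is
-- meant for x ≢ y only.
MeetIn : ∀ {k P} → Tournament k P → P → P → ℕ → Set
MeetIn {k} T x y i =
  (1 ≤ i × i ≤ k) ×
  SameSubtree T x y i ×
  (∀ {j} → j < i → 1 ≤ j → ¬ SameSubtree T x y j)

meetIn? : ∀ {k P} (T : Tournament k P) x y i → Dec (MeetIn T x y i)
meetIn? {k} T x y i =
  (1 ≤? i ×-dec i ≤? k) ×-dec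
  same? i ×-dec
  allUpTo? (λ j → 1 ≤? j →-dec ¬? (same? j)) i
  where
  same? : ∀ j → Dec (SameSubtree T x y j)
  same? j = subtree j (position T x) ≟ subtree j (position T y)

-- Seedings that differ only by exchanging the two halves of subtrees describe
-- the same tournament.
_≈_ : ∀ {k P} → Tournament k P → Tournament k P → Set
T ≈ T′ = ∀ x y → x ≢ y → ∀ i → MeetIn T x y i ⇔ MeetIn T′ x y i

-- A finite set of tournaments is given as a family; `#meetIn` and `Stable`
-- count indices, which agrees with counting elements of the set when the
-- family is injective up to _≈_.

#meetIn : ∀ {m k P} → (Fin m → Tournament k P) → P → P → ℕ → ℕ
#meetIn 𝒯 x y i = count (λ r → meetIn? (𝒯 r) x y i) (allFin _)

StableIn : ∀ {m k P} → (Fin m → Tournament k P) → ℕ → Set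
StableIn 𝒯 i = ∃[ c ] (∀ x y → x ≢ y → #meetIn 𝒯 x y i ≡ c)

Stable : ∀ {m k P} → (Fin m → Tournament k P) → Set
Stable {k = k} 𝒯 = ∀ i → 1 ≤ i → i ≤ k → StableIn 𝒯 i

-- The n ∸ 1 tournaments of the competition, n = 2 ^ k, are pairwise different.
IsSKC : ∀ {k P} → (Fin (2 ^ k ∸ 1) → Tournament k P) → Set
IsSKC 𝒯 = Injective _≡_ _≈_ 𝒯

Node : Set
Node = Fin 7

-- The nodes are labelled 1, …, 7, so that nⱼ is the element j ∸ 1 of Fin 7.
pattern n₁ = 0F
pattern n₂ = 1F
pattern n₃ = 2F
pattern n₄ = 3F
pattern n₅ = 4F
pattern n₆ = 5F
pattern n₇ = 6F

⟪_,_,_⟫ : Node → Node → Node → Subset 7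
⟪ a , b , c ⟫ = ⁅ a ⁆ ∪ ⁅ b ⁆ ∪ ⁅ c ⁆

Line : Set
Line = Fin 7

nodes : Line → Subset 7
nodes = lookup
  ( ⟪ n₃ , n₅ , n₆ ⟫
  ∷ ⟪ n₂ , n₄ , n₆ ⟫
  ∷ ⟪ n₁ , n₂ , n₃ ⟫
  ∷ ⟪ n₁ , n₆ , n₇ ⟫
  ∷ ⟪ n₃ , n₄ , n₇ ⟫
  ∷ ⟪ n₁ , n₄ , n₅ ⟫
  ∷ ⟪ n₂ , n₅ , n₇ ⟫
  ∷ [])

Player : Set
Player = Fin 8

-- Sends nⱼ to player j; player 0 is not a node.
node : Node → Player
node = suc

-- T is a tournament arising from (x , ℓ), for some choice of the order of the
-- two other lines ℓ′, ℓ″ through x and of the naming of the nodes on each line.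
record ArisesFrom (x : Node) (ℓ : Line) (T : Tournament 3 Player) : Set where
  field
    a b c d e f : Node
    ℓ′ ℓ″       : Line
    ℓ′≢ℓ        : ℓ′ ≢ ℓ
    ℓ″≢ℓ        : ℓ″ ≢ ℓ
    ℓ′≢ℓ″       : ℓ′ ≢ ℓ″
    nodes-ℓ     : nodes ℓ  ≡ ⟪ x , a , b ⟫
    nodes-ℓ′    : nodes ℓ′ ≡ ⟪ x , c , d ⟫
    nodes-ℓ″    : nodes ℓ″ ≡ ⟪ x , e , f ⟫
    seeded      : tabulate (player T) ≡
                  zero ∷ node x ∷ node a ∷ node b ∷
                  node c ∷ node d ∷ node e ∷ node f ∷ []

{-# OPTIONS --safe #-}

-- Identify the players with 𝔽₂³ through their binary digits.  The labelling of
-- the Fano plane is such that the lines, each with 0 added, are exactly the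
-- subgroups of order 4.  In a tournament arising from (x , ℓ), players y and z
-- are therefore in a common subtree of height 1 iff y ⊕ z ∈ {0, x}, and in one
-- of height 2 iff y ⊕ z ∈ {0} ∪ ℓ.  As xᵣ runs through all nodes and ℓᵣ through
-- all lines, a fixed nonzero y ⊕ z equals xᵣ once and lies on ℓᵣ three times.
module Submission where

open import Defs
open import Data.Bool using (Bool; true; false; if_then_else_; not; _xor_)
open import Data.Bool.Properties using () renaming (_≟_ to _≟ᵇ_)
open import Data.Fin using (Fin; zero; suc; toℕ; finToFun; funToFin)
open import Data.Fin.Patterns
open import Data.Fin.Properties using (all?; toℕ-injective; toℕ<n)
  renaming (_≟_ to _≟ᶠ_)
open import Data.Fin.Subset using (Subset; inside; ⁅_⁆; _∈_)
open import Data.Fin.Subset.Properties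
  using (_∈?_; x∈⁅x⁆; x∈⁅y⁆⇔x≡y; x∈⁅y⁆⇒x≡y; x∈p∪q⁻; x∈p∪q⁺; drop-there)
open import Data.Nat
  using (ℕ; zero; suc; _+_; _∸_; _*_; _/_; _^_; _≤_; _<_; _≤′_;
         ≤′-refl; ≤′-step; z≤n; s≤s; s≤s⁻¹; _≟_; _<?_)
open import Data.Nat.DivMod using (_mod_; n/1≡n; m<n⇒m/n≡0; m/n/o≡m/[n*o]; /-congʳ)
open import Data.Nat.Properties
  using (m^n≢0; m*n≢0; *-comm; +-identityʳ; m+n∸n≡m; n≤1+n; ≤⇒≤′; n<1+n;
         ≤-trans; +-0-commutativeMonoid)
open import Data.Product using (_×_; _,_; proj₁; proj₂; ∃-syntax)
open import Data.Sum using (_⊎_; inj₁; inj₂)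
open import Data.Sum.Function.Propositional using (_⊎-⇔_)
open import Data.Vec using (Vec; []; _∷_; count; lookup; tabulate; here; there)
open import Data.Vec.Properties using (≡-dec; lookup∘tabulate)
open import Algebra.Properties.CommutativeMonoid.Sum +-0-commutativeMonoid
  using (sum; sum-cong-≗; ∑-distrib-+; sum-permute)
open import Function using (id; _∘_)
open import Function.Bundles using (_⤖_; _⇔_; mk⇔; Bijection; Equivalence; Inverse)
open import Function.Properties.Bijection using (⤖⇒↔)
open import Function.Properties.Equivalence using () renaming (trans to ⇔-trans; sym to ⇔-sym)
open import Relation.Binary.PropositionalEquality
  using (_≡_; _≢_; refl; sym; trans; cong; cong₂; subst; module ≡-Reasoning)
open import Relation.Nullary
  using (Dec; yes; no; does; ¬_; contradiction; _×-dec_; _⊎-dec_; _→-dec_)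
open import Relation.Nullary.Decidable using (from-yes; dec-true; dec-false; does-⇔)
open import Relation.Unary using (Decidable)

open Equivalence using (to; from)

-- Counting

𝟙 : Bool → ℕ
𝟙 b = if b then 1 else 0

-- `A` is the difference of `C` and its part `B`, so the indicators of `A` and `B` add up to that of
-- `C`. The additive form postpones `∸` until whole counts are compared.
𝟙-difference : ∀ {A B C : Set} → A ⇔ (C × ¬ B) → (B → C) →
               (a? : Dec A) (b? : Dec B) (c? : Dec C) →
               𝟙 (does a?) + 𝟙 (does b?) ≡ 𝟙 (does c?)
𝟙-difference A⇔C∖B B⇒C a? (yes b) c? =
  trans (cong (λ u → 𝟙 u + 1) (dec-false a? (λ a → proj₂ (to A⇔C∖B a) b)))
    (sym (cong 𝟙 (dec-true c? (B⇒C b))))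
𝟙-difference A⇔C∖B B⇒C a? (no ¬b) c? =
  trans (+-identityʳ _) (cong 𝟙 (does-⇔ (⇔-trans A⇔C∖B (mk⇔ proj₁ (_, ¬b))) a? c?))

count-tabulate : ∀ {A : Set} {Q : A → Set} (Q? : Decidable Q) {n} (f : Fin n → A) →
                 count Q? (tabulate f) ≡ sum (λ r → 𝟙 (does (Q? (f r))))
count-tabulate Q? {zero}  f = refl
count-tabulate Q? {suc n} f with does (Q? (f zero))
... | true  = cong suc (count-tabulate Q? (f ∘ suc))
... | false = count-tabulate Q? (f ∘ suc)

sum-reindex : ∀ {n} (π : Fin n ⤖ Fin n) (f : Fin n → ℕ) →
              sum (f ∘ Bijection.to π) ≡ sum f
sum-reindex π f = sym (sum-permute f (⤖⇒↔ π))

-- Rounds and common subtrees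

subtree-suc : ∀ i p → subtree (suc i) p ≡ subtree i p / 2
subtree-suc i p = begin
  p / (2 * 2 ^ i)  ≡⟨ /-congʳ (*-comm 2 (2 ^ i)) ⟩
  p / (2 ^ i * 2)  ≡⟨ m/n/o≡m/[n*o] p (2 ^ i) 2 ⟨
  p / 2 ^ i / 2    ∎
  where
  open ≡-Reasoning
  instance
    _ = m^n≢0 2 i
    _ = m^n≢0 2 (suc i)
    _ = m*n≢0 (2 ^ i) 2

module _ {k : ℕ} {P : Set} (T : Tournament k P) where

  same? : ∀ y z i → Dec (SameSubtree T y z i)
  same? y z i = subtree i (position T y) ≟ subtree i (position T z)

  player-injective : ∀ {p q} → player T p ≡ player T q → p ≡ q
  player-injective {p} {q} eq =
    trans (sym (Inverse.strictlyInverseʳ (seeding T) p))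
      (trans (cong (Inverse.from (seeding T)) eq) (Inverse.strictlyInverseʳ (seeding T) q))

  same-zero⇒≡ : ∀ {y z} → SameSubtree T y z 0 → y ≡ z
  same-zero⇒≡ {y} {z} eq =
    trans (sym (Inverse.strictlyInverseˡ (seeding T) y))
      (trans (cong (player T) (toℕ-injective (trans (sym (n/1≡n _)) (trans eq (n/1≡n _)))))
        (Inverse.strictlyInverseˡ (seeding T) z))

  -- Every position is below `2 ^ k`, so its quotient at height `k` is 0.
  same-top : ∀ y z → SameSubtree T y z k
  same-top y z = trans (position/ y) (sym (position/ z))
    where
    position/ : ∀ y → subtree k (position T y) ≡ 0
    position/ y = m<n⇒m/n≡0 {{m^n≢0 2 k}} (toℕ<n (Inverse.from (seeding T) y))

  same-mono′ : ∀ {y z i j} → i ≤′ j → SameSubtree T y z i → SameSubtree T y z j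
  same-mono′ ≤′-refl eq = eq
  same-mono′ (≤′-step {j} i≤j) eq =
    trans (subtree-suc j _) (trans (cong (_/ 2) (same-mono′ i≤j eq)) (sym (subtree-suc j _)))

  same-mono : ∀ {y z i j} → i ≤ j → SameSubtree T y z i → SameSubtree T y z j
  same-mono = same-mono′ ∘ ≤⇒≤′

  -- Subtrees are nested, so minimality only has to be tested one height below. For round 1 there is
  -- no earlier round to exclude, and `y ≢ z` takes over: a subtree of height 0 is a single leaf.
  meetIn⇔ : ∀ {y z i} → y ≢ z → i < k →
            MeetIn T y z (suc i) ⇔ (SameSubtree T y z (suc i) × ¬ SameSubtree T y z i)
  meetIn⇔ {y} {z} {i} y≢z i<k = mk⇔
    (λ (_ , same , minimal) → same , separate i minimal)
    (λ (same , ¬same) → (s≤s z≤n , i<k) , same , λ j<1+i _ → ¬same ∘ same-mono (s≤s⁻¹ j<1+i))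
    where
    separate : ∀ i → (∀ {j} → j < suc i → 1 ≤ j → ¬ SameSubtree T y z j) → ¬ SameSubtree T y z i
    separate zero    _       = y≢z ∘ same-zero⇒≡
    separate (suc i) minimal = minimal (n<1+n (suc i)) (s≤s z≤n)

#same : ∀ {m k P} → (Fin m → Tournament k P) → P → P → ℕ → ℕ
#same 𝒯 y z i = sum (λ r → 𝟙 (does (same? (𝒯 r) y z i)))

#meetIn+#same : ∀ {m k P} (𝒯 : Fin m → Tournament k P) {y z i} → y ≢ z → i < k →
                #meetIn 𝒯 y z (suc i) + #same 𝒯 y z i ≡ #same 𝒯 y z (suc i)
#meetIn+#same 𝒯 {y} {z} {i} y≢z i<k = begin
  #meetIn 𝒯 y z (suc i) + #same 𝒯 y z i
    ≡⟨ cong (_+ #same 𝒯 y z i) (count-tabulate (λ r → meetIn? (𝒯 r) y z (suc i)) id) ⟩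
  sum (λ r → 𝟙 (does (meetIn? (𝒯 r) y z (suc i)))) + #same 𝒯 y z i
    ≡⟨ ∑-distrib-+ _ (λ r → 𝟙 (does (same? (𝒯 r) y z i))) ⟨
  sum (λ r → 𝟙 (does (meetIn? (𝒯 r) y z (suc i))) + 𝟙 (does (same? (𝒯 r) y z i)))
    ≡⟨ sum-cong-≗ (λ r → 𝟙-difference (meetIn⇔ (𝒯 r) y≢z i<k) (same-mono (𝒯 r) (n≤1+n i))
         (meetIn? (𝒯 r) y z (suc i)) (same? (𝒯 r) y z i) (same? (𝒯 r) y z (suc i))) ⟩
  #same 𝒯 y z (suc i) ∎
  where open ≡-Reasoning

-- The counts `#same` are cumulative over rounds, so the count for one round is the difference of
-- two consecutive ones.
stable-from-#same : ∀ {m k P} (𝒯 : Fin m → Tournament k P) (c : ℕ → ℕ) →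
                    (∀ i → i ≤ k → ∀ y z → y ≢ z → #same 𝒯 y z i ≡ c i) → Stable 𝒯
stable-from-#same 𝒯 c #same≡c (suc i) _ i<k = c (suc i) ∸ c i , λ y z y≢z → begin
  #meetIn 𝒯 y z (suc i)
    ≡⟨ m+n∸n≡m _ (#same 𝒯 y z i) ⟨
  #meetIn 𝒯 y z (suc i) + #same 𝒯 y z i ∸ #same 𝒯 y z i
    ≡⟨ cong (_∸ #same 𝒯 y z i) (#meetIn+#same 𝒯 y≢z i<k) ⟩
  #same 𝒯 y z (suc i) ∸ #same 𝒯 y z i
    ≡⟨ cong₂ _∸_ (#same≡c (suc i) i<k y z y≢z) (#same≡c i (≤-trans (n≤1+n i) i<k) y z y≢z) ⟩
  c (suc i) ∸ c i ∎
  where open ≡-Reasoning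

-- The Fano plane inside 𝔽₂³

infixl 6 _⊕_
-- Addition in 𝔽₂³, digit by digit without carry. It serves both for players and for leaf positions,
-- which are also elements of `Fin 8`.
_⊕_ : Player → Player → Player
y ⊕ z = funToFin {3} λ i → (toℕ (finToFun {2} y i) + toℕ (finToFun {2} z i)) mod 2

⊕-identityˡ : ∀ y → zero ⊕ y ≡ y
⊕-identityˡ = from-yes (all? λ y → zero ⊕ y ≟ᶠ y)

⊕-identityʳ : ∀ y → y ⊕ zero ≡ y
⊕-identityʳ = from-yes (all? λ y → y ⊕ zero ≟ᶠ y)

⊕-self : ∀ y → y ⊕ y ≡ zero
⊕-self = from-yes (all? λ y → y ⊕ y ≟ᶠ zero)

-- Every element is its own inverse.
⊕-solve : ∀ y {z w} → y ⊕ z ≡ w ⇔ z ≡ w ⊕ y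
⊕-solve y {z} {w} = mk⇔
  (λ eq → trans (sym (cancelˡ y z)) (cong (_⊕ y) eq))
  (λ eq → trans (cong (y ⊕_) eq) (cancelʳ y w))
  where
  cancelˡ : ∀ y z → y ⊕ z ⊕ y ≡ z
  cancelˡ = from-yes (all? λ y → all? λ z → y ⊕ z ⊕ y ≟ᶠ z)
  cancelʳ : ∀ y w → y ⊕ (w ⊕ y) ≡ w
  cancelʳ = from-yes (all? λ y → all? λ w → y ⊕ (w ⊕ y) ≟ᶠ w)

⊕-nonzero : ∀ {y z} → y ≢ z → y ⊕ z ≢ zero
⊕-nonzero {y} y≢z eq = y≢z (sym (trans (to (⊕-solve y) eq) (⊕-identityˡ y)))

-- As a set of players, inside ∷ S is {0} ∪ S.
infix 4 _∈₀?_
_∈₀?_ : (y : Player) (S : Subset 7) → Dec (y ∈ inside ∷ S)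
y ∈₀? S = y ∈? (inside ∷ S)

-- The three nodes of a line sum to zero in 𝔽₂³; this is where the labelling of the Fano plane
-- enters.
third-node : ∀ ℓ x a b → nodes ℓ ≡ ⟪ x , a , b ⟫ →
             node b ≡ node x ⊕ node a × node a ≡ node x ⊕ node b
third-node = from-yes (all? λ ℓ → all? λ x → all? λ a → all? λ b →
  ≡-dec _≟ᵇ_ (nodes ℓ) ⟪ x , a , b ⟫ →-dec
  (node b ≟ᶠ node x ⊕ node a ×-dec node a ≟ᶠ node x ⊕ node b))

-- {0} ∪ ℓ is a subgroup of index 2, so a difference lies in it exactly when both terms are in the
-- subgroup or both are in its other coset.
line-index-2 : ∀ ℓ y z → does (y ⊕ z ∈₀? nodes ℓ) ≡
                         not (does (y ∈₀? nodes ℓ) xor does (z ∈₀? nodes ℓ))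
line-index-2 = from-yes (all? λ ℓ → all? λ y → all? λ z →
  does (y ⊕ z ∈₀? nodes ℓ) ≟ᵇ
  not (does (y ∈₀? nodes ℓ) xor does (z ∈₀? nodes ℓ)))

lines-through-node : ∀ d → sum (λ ℓ → 𝟙 (does (d ∈? nodes ℓ))) ≡ 3
lines-through-node = from-yes (all? λ d → sum (λ ℓ → 𝟙 (does (d ∈? nodes ℓ))) ≟ 3)

singletons-through-node : ∀ (d : Node) → sum (λ x → 𝟙 (does (d ∈? ⁅ x ⁆))) ≡ 1
singletons-through-node =
  from-yes (all? λ (d : Node) → sum (λ x → 𝟙 (does (d ∈? ⁅ x ⁆))) ≟ 1)

∈₀⁅⁆⇔ : ∀ {w x} → w ∈ inside ∷ ⁅ x ⁆ ⇔ (w ≡ zero ⊎ w ≡ node x)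
∈₀⁅⁆⇔ {zero}      = mk⇔ (λ _ → inj₁ refl) (λ _ → here)
∈₀⁅⁆⇔ {suc w} {x} = mk⇔
  (λ w∈ → inj₂ (cong suc (x∈⁅y⁆⇒x≡y x (drop-there w∈))))
  λ { (inj₂ refl) → there (x∈⁅x⁆ x) }

∈⟪⟫⇔ : ∀ {w x a b} → w ∈ ⟪ x , a , b ⟫ ⇔ (w ≡ x ⊎ w ≡ a ⊎ w ≡ b)
∈⟪⟫⇔ {w} {x} {a} {b} = ⇔-trans
  (mk⇔ (x∈p∪q⁻ ⁅ x ⁆ _) x∈p∪q⁺)
  (x∈⁅y⁆⇔x≡y ⊎-⇔ ⇔-trans (mk⇔ (x∈p∪q⁻ ⁅ a ⁆ ⁅ b ⁆) x∈p∪q⁺) (x∈⁅y⁆⇔x≡y ⊎-⇔ x∈⁅y⁆⇔x≡y))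

-- Tournaments arising from a node-line pair

module _ {x : Node} {ℓ : Line} {T : Tournament 3 Player} (arises : ArisesFrom x ℓ T) where
  open ArisesFrom arises

  seeds : Vec Player 8
  seeds = zero ∷ node x ∷ node a ∷ node b ∷ node c ∷ node d ∷ node e ∷ node f ∷ []

  player≡seed : ∀ p → player T p ≡ lookup seeds p
  player≡seed p = trans (sym (lookup∘tabulate (player T) p)) (cong (λ v → lookup v p) seeded)

  -- Adding `1F` flips the last binary digit of a position, which leads to the sibling leaf. The
  -- pairs seeded there are {0, x} and the pairs that `x` completes to a line, and each pair differs
  -- by `x`.
  player-sibling : ∀ p → player T (1F ⊕ p) ≡ node x ⊕ player T p
  player-sibling p =
    trans (player≡seed (1F ⊕ p)) (trans (seed-sibling p) (cong (node x ⊕_) (sym (player≡seed p))))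
    where
    seed-sibling : ∀ p → lookup seeds (1F ⊕ p) ≡ node x ⊕ lookup seeds p
    seed-sibling 0F = sym (⊕-identityʳ (node x))
    seed-sibling 1F = sym (⊕-self (node x))
    seed-sibling 2F = proj₁ (third-node ℓ x a b nodes-ℓ)
    seed-sibling 3F = proj₂ (third-node ℓ x a b nodes-ℓ)
    seed-sibling 4F = proj₁ (third-node ℓ′ x c d nodes-ℓ′)
    seed-sibling 5F = proj₂ (third-node ℓ′ x c d nodes-ℓ′)
    seed-sibling 6F = proj₁ (third-node ℓ″ x e f nodes-ℓ″)
    seed-sibling 7F = proj₂ (third-node ℓ″ x e f nodes-ℓ″)

  -- If moving by `g` among positions is adding `h` among players, then differences `g` and `h`
  -- correspond. The converse direction rests on injectivity of the seeding.
  translation : ∀ {g h} → (∀ p → player T (g ⊕ p) ≡ h ⊕ player T p) →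
                ∀ p q → p ⊕ q ≡ g ⇔ player T p ⊕ player T q ≡ h
  translation {g} {h} shift p q = mk⇔
    (λ eq → from (⊕-solve (player T p)) (trans (cong (player T) (to (⊕-solve p) eq)) (shift p)))
    (λ eq → from (⊕-solve p)
      (player-injective T (trans (to (⊕-solve (player T p)) eq) (sym (shift p)))))

  subtree-1 : ∀ p q → subtree 1 (toℕ p) ≡ subtree 1 (toℕ q) ⇔
                      player T p ⊕ player T q ∈ inside ∷ ⁅ x ⁆
  subtree-1 p q = ⇔-trans (siblings p q) (⇔-trans
    (translation shift-0 p q ⊎-⇔ translation player-sibling p q)
    (⇔-sym ∈₀⁅⁆⇔))
    where
    shift-0 : ∀ p → player T (zero ⊕ p) ≡ zero ⊕ player T p
    shift-0 p = trans (cong (player T) (⊕-identityˡ p)) (sym (⊕-identityˡ (player T p)))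
    siblings : ∀ (p q : Fin 8) → subtree 1 (toℕ p) ≡ subtree 1 (toℕ q) ⇔ (p ⊕ q ≡ 0F ⊎ p ⊕ q ≡ 1F)
    siblings p q = mk⇔ (proj₁ (both p q)) (proj₂ (both p q))
      where
      both : ∀ (p q : Fin 8) →
             (subtree 1 (toℕ p) ≡ subtree 1 (toℕ q) → p ⊕ q ≡ 0F ⊎ p ⊕ q ≡ 1F) ×
             (p ⊕ q ≡ 0F ⊎ p ⊕ q ≡ 1F → subtree 1 (toℕ p) ≡ subtree 1 (toℕ q))
      both = from-yes (all? λ (p : Fin 8) → all? λ (q : Fin 8) →
        (subtree 1 (toℕ p) ≟ subtree 1 (toℕ q) →-dec (p ⊕ q ≟ᶠ 0F ⊎-dec p ⊕ q ≟ᶠ 1F)) ×-dec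
        ((p ⊕ q ≟ᶠ 0F ⊎-dec p ⊕ q ≟ᶠ 1F) →-dec subtree 1 (toℕ p) ≟ subtree 1 (toℕ q)))

  -- The first four seeds are 0, x, a, b, which make up {0} ∪ ℓ; injectivity of the seeding keeps
  -- these players out of the other positions.
  first-half : ∀ p → player T p ∈ inside ∷ nodes ℓ ⇔ toℕ p < 4
  first-half p = mk⇔
    (λ p∈ → let q , q<4 , eq = among-first p∈ in
      subst (λ r → toℕ r < 4) (sym (player-injective T eq)) q<4)
    (λ p<4 → subst (_∈ inside ∷ nodes ℓ) (sym (player≡seed p)) (first-four p p<4))
    where
    on-line : ∀ {w} → w ≡ x ⊎ w ≡ a ⊎ w ≡ b → node w ∈ inside ∷ nodes ℓ
    on-line w = there (subst (_ ∈_) (sym nodes-ℓ) (from ∈⟪⟫⇔ w))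

    first-four : ∀ p → toℕ p < 4 → lookup seeds p ∈ inside ∷ nodes ℓ
    first-four 0F _ = here
    first-four 1F _ = on-line (inj₁ refl)
    first-four 2F _ = on-line (inj₂ (inj₁ refl))
    first-four 3F _ = on-line (inj₂ (inj₂ refl))
    first-four (suc (suc (suc (suc _)))) (s≤s (s≤s (s≤s (s≤s ()))))

    among-first : ∀ {w} → w ∈ inside ∷ nodes ℓ → ∃[ q ] (toℕ q < 4 × w ≡ player T q)
    among-first {zero} _ = 0F , from-yes (0 <? 4) , sym (player≡seed 0F)
    among-first {suc w} w∈ with to ∈⟪⟫⇔ (subst (w ∈_) nodes-ℓ (drop-there w∈))
    ... | inj₁ refl        = 1F , from-yes (1 <? 4) , sym (player≡seed 1F)
    ... | inj₂ (inj₁ refl) = 2F , from-yes (2 <? 4) , sym (player≡seed 2F)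
    ... | inj₂ (inj₂ refl) = 3F , from-yes (3 <? 4) , sym (player≡seed 3F)

  -- The two subtrees of height 2 are the two halves of the seeding, and these are the two cosets of
  -- {0} ∪ ℓ.
  subtree-2 : ∀ p q → does (subtree 2 (toℕ p) ≟ subtree 2 (toℕ q)) ≡
                      does (player T p ⊕ player T q ∈₀? nodes ℓ)
  subtree-2 p q = begin
    does (subtree 2 (toℕ p) ≟ subtree 2 (toℕ q))
      ≡⟨ halves p q ⟩
    not (does (toℕ p <? 4) xor does (toℕ q <? 4))
      ≡⟨ cong₂ (λ u v → not (u xor v)) (half p) (half q) ⟨
    not (does (player T p ∈₀? nodes ℓ) xor does (player T q ∈₀? nodes ℓ))
      ≡⟨ line-index-2 ℓ (player T p) (player T q) ⟨
    does (player T p ⊕ player T q ∈₀? nodes ℓ) ∎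
    where
    open ≡-Reasoning
    half : ∀ p → does (player T p ∈₀? nodes ℓ) ≡ does (toℕ p <? 4)
    half p = does-⇔ (first-half p) (player T p ∈₀? nodes ℓ) (toℕ p <? 4)
    halves : ∀ (p q : Fin 8) → does (subtree 2 (toℕ p) ≟ subtree 2 (toℕ q)) ≡
                               not (does (toℕ p <? 4) xor does (toℕ q <? 4))
    halves = from-yes (all? λ (p : Fin 8) → all? λ (q : Fin 8) →
      does (subtree 2 (toℕ p) ≟ subtree 2 (toℕ q)) ≟ᵇ
      not (does (toℕ p <? 4) xor does (toℕ q <? 4)))

  same-1 : ∀ y z → SameSubtree T y z 1 ⇔ y ⊕ z ∈ inside ∷ ⁅ x ⁆
  same-1 y z =
    subst (λ w → SameSubtree T y z 1 ⇔ w ∈ inside ∷ ⁅ x ⁆) (cong₂ _⊕_ (reseat y) (reseat z))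
      (subtree-1 _ _)
    -- Seating a player and reading off its seat returns the player, so the claim about positions
    -- becomes one about `y` and `z`.
    where reseat = Inverse.strictlyInverseˡ (seeding T)

  same-2 : ∀ y z → does (same? T y z 2) ≡ does (y ⊕ z ∈₀? nodes ℓ)
  same-2 y z = trans (subtree-2 _ _)
    (cong (λ w → does (w ∈₀? nodes ℓ)) (cong₂ _⊕_ (reseat y) (reseat z)))
    where reseat = Inverse.strictlyInverseˡ (seeding T)

  -- The first opponent of player 0 recovers `x` from the tournament, which serves to tell the seven
  -- tournaments apart.
  meet-0-in-round-1 : ∀ y → MeetIn T zero (node y) 1 ⇔ y ≡ x
  meet-0-in-round-1 y = mk⇔
    (λ meet → x∈⁅y⁆⇒x≡y x (drop-there (to same (proj₁ (to meet⇔ meet)))))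
    (λ { refl → from meet⇔
      (from same (there (x∈⁅x⁆ x)) , λ eq → contradiction (same-zero⇒≡ T eq) λ ()) })
    where
    meet⇔ = meetIn⇔ T {zero} {node y} {0} (λ ()) (s≤s z≤n)
    same : SameSubtree T zero (node y) 1 ⇔ node y ∈ inside ∷ ⁅ x ⁆
    same = subst (λ w → SameSubtree T zero (node y) 1 ⇔ w ∈ inside ∷ ⁅ x ⁆)
      (⊕-identityˡ (node y)) (same-1 zero (node y))

-- Through `π` the sum over tournaments becomes a sum over all nodes or all lines. Since `y ⊕ z` is
-- nonzero it is a node, and the sum is the number of sets `S j` containing that node.
#same-reindex : ∀ (T : Fin 7 → Tournament 3 Player) i {c}
                (π : Fin 7 ⤖ Fin 7) (S : Fin 7 → Subset 7) →
                (∀ d → sum (λ j → 𝟙 (does (d ∈? S j))) ≡ c) →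
                ∀ {y z} → y ≢ z →
                (∀ r → does (same? (T r) y z i) ≡ does (y ⊕ z ∈₀? S (Bijection.to π r))) →
                #same T y z i ≡ c
#same-reindex T i {c} π S incidences {y} {z} y≢z same≡ = begin
  #same T y z i
    ≡⟨ sum-cong-≗ (cong 𝟙 ∘ same≡) ⟩
  sum (λ r → 𝟙 (does (y ⊕ z ∈₀? S (Bijection.to π r))))
    ≡⟨ sum-reindex π (λ j → 𝟙 (does (y ⊕ z ∈₀? S j))) ⟩
  sum (λ j → 𝟙 (does (y ⊕ z ∈₀? S j)))
    ≡⟨ nonzero (⊕-nonzero y≢z) ⟩
  c ∎
  where
  open ≡-Reasoning
  nonzero : ∀ {w} → w ≢ zero → sum (λ j → 𝟙 (does (w ∈₀? S j))) ≡ c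
  nonzero {zero}  w≢0 = contradiction refl w≢0
  nonzero {suc d} _   = incidences d

theorem2p1 : (x : Fin 7 ⤖ Node) (ℓ : Fin 7 ⤖ Line) →
    (∀ r → Bijection.to x r ∈ nodes (Bijection.to ℓ r)) →
    (T : Fin 7 → Tournament 3 Player) →
    (∀ r → ArisesFrom (Bijection.to x r) (Bijection.to ℓ r) (T r)) →
    IsSKC T × Stable T
-- The cumulative counts at heights 0, 1, 2, 3 are 0, 1, 3, 7, so each pair can meet in rounds 1, 2,
-- 3 of exactly 1, 2, 4 tournaments.
theorem2p1 x ℓ _ T arises = distinct , stable-from-#same T (λ i → 2 ^ i ∸ 1) #same≡
  where
  distinct : IsSKC T
  -- Equal tournaments give player 0 the same first opponent, and the enumeration `x` lists each
  -- node only once.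
  distinct {r} {s} Tᵣ≈Tₛ = Bijection.injective x
    (to (meet-0-in-round-1 (arises s) xᵣ)
      (to (Tᵣ≈Tₛ zero (node xᵣ) (λ ()) 1) (from (meet-0-in-round-1 (arises r) xᵣ) refl)))
    where xᵣ = Bijection.to x r

  #same≡ : ∀ i → i ≤ 3 → ∀ y z → y ≢ z → #same T y z i ≡ 2 ^ i ∸ 1
  #same≡ 0 _ y z y≢z = sum-cong-≗ (λ r →
    cong 𝟙 (dec-false (same? (T r) y z 0) (y≢z ∘ same-zero⇒≡ (T r))))
  #same≡ 1 _ y z y≢z = #same-reindex T 1 x ⁅_⁆ singletons-through-node y≢z (λ r →
    does-⇔ (same-1 (arises r) y z) (same? (T r) y z 1) (y ⊕ z ∈₀? ⁅ Bijection.to x r ⁆))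
  #same≡ 2 _ y z y≢z = #same-reindex T 2 ℓ nodes lines-through-node y≢z (λ r →
    same-2 (arises r) y z)
  -- At the root all seven tournaments count.
  #same≡ 3 _ y z _ = sum-cong-≗ (λ r →
    cong 𝟙 (dec-true (same? (T r) y z 3) (same-top (T r) y z)))
  #same≡ (suc (suc (suc (suc _)))) (s≤s (s≤s (s≤s ())))
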